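{- Let $m\geq 2$ be an integer, and let $S=\{a_1^m,\ldots,a_k^m\}$ be a set of $k$ distinct $m$th powers of integers $a_1,\ldots,a_k$. Define polynomials in $\mathbb{Z}[x]$ by \[ g(x)=(x-a_1)\cdots(x-a_k),\qquad f_S(x)=\bigl(x(x^2+1)g(x)\bigr)^{4m}+(x^{2m}-x^2+2)\,g(x)^{2m}+x^m . \] Then: (i) $S\subseteq f_S(\mathbb{Z})\cap \mathcal{P}_m$; (ii) $f_S(x)\notin \mathcal{P}_m$ for every $x\in \mathbb{Z}\setminus\{0,a_1,\ldots,a_k\}$; (iii) $f_S(\mathbb{Z})\cap \mathcal{P}_m=S$.
   Context: For an integer $m\geq 2$, $\mathcal{P}_m=\{a^m : a\in\mathbb{Z}\}$ denotes the set of all perfect $m$th powers of integers. For a polynomial $f\in\mathbb{Z}[x]$, $f(\mathbb{Z})=\{f(n): n\in\mathbb{Z}\}$. An empty product equals $1$. -}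

module Defs where

open import Data.Nat as ℕ using (ℕ; zero; suc)
open import Data.Integer using (ℤ; +_; 0ℤ; 1ℤ; _+_; _*_; -_; _^_)
open import Data.List using (List; []; _∷_; map)
open import Data.Product using (∃-syntax)
open import Data.Vec.Functional using (Vector; foldr)
open import Level using (0ℓ)
open import Relation.Binary.PropositionalEquality using (_≡_)
open import Relation.Unary using (Pred)

-- ℤ[x], as coefficient lists with the constant term first.  Trailing zeros are
-- allowed, so one polynomial has many representations.

ℤ[x] : Set
ℤ[x] = List ℤ

const : ℤ → ℤ[x]
const c = c ∷ []

X : ℤ[x]
X = 0ℤ ∷ 1ℤ ∷ []

infixl 6 _⊕_ _⊖_
infixl 7 _⊗_
infixr 8 _↑_

_⊕_ : ℤ[x] → ℤ[x] → ℤ[x]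
[]      ⊕ q       = q
(c ∷ p) ⊕ []      = c ∷ p
(c ∷ p) ⊕ (d ∷ q) = (c + d) ∷ (p ⊕ q)

_⊖_ : ℤ[x] → ℤ[x] → ℤ[x]
p ⊖ q = p ⊕ map -_ q

_⊗_ : ℤ[x] → ℤ[x] → ℤ[x]
[]      ⊗ q = []
(c ∷ p) ⊗ q = map (c *_) q ⊕ (0ℤ ∷ (p ⊗ q))

_↑_ : ℤ[x] → ℕ → ℤ[x]
p ↑ zero  = const 1ℤ
p ↑ suc n = p ⊗ (p ↑ n)

∏ : ∀ {k} → Vector ℤ[x] k → ℤ[x]
∏ = foldr _⊗_ (const 1ℤ)

eval : ℤ[x] → ℤ → ℤ
eval []      n = 0ℤ
eval (c ∷ p) n = c + n * eval p n

Values : ℤ[x] → Pred ℤ 0ℓ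
Values f z = ∃[ n ] z ≡ eval f n

𝒫 : ℕ → Pred ℤ 0ℓ
𝒫 m z = ∃[ a ] z ≡ a ^ m

Powers : ∀ {k} → ℕ → Vector ℤ k → Pred ℤ 0ℓ
Powers m a z = ∃[ i ] z ≡ a i ^ m

g : ∀ {k} → Vector ℤ k → ℤ[x]
g a = ∏ (λ i → X ⊖ const (a i))

-- For even m this depends on the chosen roots aᵢ, not only on the set of
-- their m-th powers.
fₛ : ∀ {k} → ℕ → Vector ℤ k → ℤ[x]
fₛ m a =
  (X ⊗ (X ↑ 2 ⊕ const 1ℤ) ⊗ g a) ↑ (4 ℕ.* m)
  ⊕ (X ↑ (2 ℕ.* m) ⊖ X ↑ 2 ⊕ const (+ 2)) ⊗ g a ↑ (2 ℕ.* m)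
  ⊕ X ↑ m

{-# OPTIONS --safe #-}

-- If x ≠ 0 and g(x) ≠ 0, put M = (x(x²+1)g(x))⁴.  Then fₛ(x) exceeds M^m by
-- (x^{2m} − x² + 2) g(x)^{2m} + x^m, which is positive because
-- x^{2m} − x² + 2 > |x|^m, and is smaller than M^{m−1} because
-- M^{m−1} ≥ (x(x²+1)g(x))^{2m} ≥ 4 x^{2m} g(x)^{2m}.  Hence fₛ(x) lies strictly
-- between M^m and (M+1)^m.  If g(0) ≠ 0, then fₛ(0) = 2 (g(0)²)^m, which is not
-- an m-th power since m ≥ 2.

module Submission where

open import Defs
open import Data.Nat as ℕ using (ℕ; zero; suc; _≥_; z≤n; s≤s)
import Data.Nat.Properties as ℕ
open import Data.Nat.Divisibility using (_∣_; divides; divides-refl; ∣1⇒≡1)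
open import Data.Nat.Induction using (<-rec)
open import Data.Nat.Primality
  using (Prime; prime[2]; ¬prime[1]; euclidsLemma; prime⇒nonZero; prime⇒nonTrivial)
import Data.Nat.Tactic.RingSolver as ℕ-Solver
open import Data.Fin using (zero; suc)
open import Data.Fin.Properties using (any?)
open import Data.Integer
  using (ℤ; +_; -[1+_]; ∣_∣; 0ℤ; 1ℤ; _+_; _*_; -_; _-_; _^_)
import Data.Integer.Properties as ℤ
open import Data.Integer.Tactic.RingSolver using (solve-∀)
open import Data.List using ([]; _∷_; map)
open import Data.Product using (_×_; _,_)
open import Data.Sum using (inj₁; inj₂)
open import Data.Vec.Functional using (Vector)
open import Function using (_∘_)
open import Function.Definitions using (Injective)
open import Relation.Binary.PropositionalEquality
  using (_≡_; _≢_; refl; sym; trans; cong; cong₂; subst; module ≡-Reasoning)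
open import Relation.Nullary using (yes; no; contradiction)
open import Relation.Unary using (_⊆_; _∩_; _≐_; _∉_)

-- Evaluation of polynomials

eval-⊕ : ∀ p q n → eval (p ⊕ q) n ≡ eval p n + eval q n
eval-⊕ []      q       n = sym (ℤ.+-identityˡ _)
eval-⊕ (c ∷ p) []      n = sym (ℤ.+-identityʳ _)
eval-⊕ (c ∷ p) (d ∷ q) n rewrite eval-⊕ p q n =
  interchange c d n (eval p n) (eval q n)
  where
  interchange : ∀ c d n u v →
    c + d + n * (u + v) ≡ c + n * u + (d + n * v)
  interchange = solve-∀

eval-scale : ∀ c p n → eval (map (c *_) p) n ≡ c * eval p n
eval-scale c []      n = sym (ℤ.*-zeroʳ c)
eval-scale c (d ∷ p) n rewrite eval-scale c p n = factor c d n (eval p n)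
  where
  factor : ∀ c d n u → c * d + n * (c * u) ≡ c * (d + n * u)
  factor = solve-∀

eval-neg : ∀ p n → eval (map -_ p) n ≡ - eval p n
eval-neg []      n = refl
eval-neg (d ∷ p) n rewrite eval-neg p n = factor d n (eval p n)
  where
  factor : ∀ d n u → - d + n * - u ≡ - (d + n * u)
  factor = solve-∀

eval-⊖ : ∀ p q n → eval (p ⊖ q) n ≡ eval p n - eval q n
eval-⊖ p q n rewrite eval-⊕ p (map -_ q) n | eval-neg q n = refl

eval-⊗ : ∀ p q n → eval (p ⊗ q) n ≡ eval p n * eval q n
eval-⊗ []      q n = refl
eval-⊗ (c ∷ p) q n
  rewrite eval-⊕ (map (c *_) q) (0ℤ ∷ (p ⊗ q)) n
        | eval-scale c q n
        | eval-⊗ p q n = factor c n (eval p n) (eval q n)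
  where
  factor : ∀ c n u v → c * v + (0ℤ + n * (u * v)) ≡ (c + n * u) * v
  factor = solve-∀

eval-const : ∀ c n → eval (const c) n ≡ c
eval-const c n rewrite ℤ.*-zeroʳ n = ℤ.+-identityʳ c

eval-X : ∀ n → eval X n ≡ n
eval-X = identity
  where
  identity : ∀ n → 0ℤ + n * (1ℤ + n * 0ℤ) ≡ n
  identity = solve-∀

eval-↑ : ∀ p k n → eval (p ↑ k) n ≡ eval p n ^ k
eval-↑ p zero    n = eval-const 1ℤ n
eval-↑ p (suc k) n rewrite eval-⊗ p (p ↑ k) n | eval-↑ p k n = refl

eval-X↑ : ∀ k n → eval (X ↑ k) n ≡ n ^ k
eval-X↑ k n = trans (eval-↑ X k n) (cong (_^ k) (eval-X n))

eval-X⊖const : ∀ c n → eval (X ⊖ const c) n ≡ n - c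
eval-X⊖const c n = trans (eval-⊖ X (const c) n) (cong₂ _-_ (eval-X n) (eval-const c n))

eval-g-suc : ∀ {k} (a : Vector ℤ (suc k)) n →
  eval (g a) n ≡ (n - a zero) * eval (g (a ∘ suc)) n
eval-g-suc a n = trans (eval-⊗ (X ⊖ const (a zero)) (g (a ∘ suc)) n)
  (cong (_* eval (g (a ∘ suc)) n) (eval-X⊖const (a zero) n))

g-root : ∀ {k} (a : Vector ℤ k) i → eval (g a) (a i) ≡ 0ℤ
g-root a zero rewrite eval-g-suc a (a zero) | ℤ.+-inverseʳ (a zero) = refl
g-root a (suc i) rewrite eval-g-suc a (a (suc i)) | g-root (a ∘ suc) i =
  ℤ.*-zeroʳ (a (suc i) - a zero)

g-nonroot : ∀ {k} (a : Vector ℤ k) n → (∀ i → n ≢ a i) → eval (g a) n ≢ 0ℤ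
g-nonroot {zero}  a n n≢a eq = contradiction (trans (sym (eval-const 1ℤ n)) eq) λ ()
g-nonroot {suc k} a n n≢a eq
  with ℤ.i*j≡0⇒i≡0∨j≡0 (n - a zero) (trans (sym (eval-g-suc a n)) eq)
... | inj₁ n-a₀≡0 = n≢a zero (ℤ.i-j≡0⇒i≡j n (a zero) n-a₀≡0)
... | inj₂ g≡0    = g-nonroot (a ∘ suc) n (n≢a ∘ suc) g≡0

-- Evaluation is a ring homomorphism, so coefficient lists can be left behind here. The value of `g`
-- stays a single integer `G`: below it only matters whether it vanishes.
eval-fₛ : ∀ {k} m (a : Vector ℤ k) n → let G = eval (g a) n in
  eval (fₛ m a) n ≡
    (n * (n ^ 2 + 1ℤ) * G) ^ (4 ℕ.* m) + (n ^ (2 ℕ.* m) - n ^ 2 + + 2) * G ^ (2 ℕ.* m) + n ^ m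
eval-fₛ m a n
  rewrite eval-⊕ ((X ⊗ (X ↑ 2 ⊕ const 1ℤ) ⊗ g a) ↑ (4 ℕ.* m)
                    ⊕ (X ↑ (2 ℕ.* m) ⊖ X ↑ 2 ⊕ const (+ 2)) ⊗ g a ↑ (2 ℕ.* m)) (X ↑ m) n
        | eval-⊕ ((X ⊗ (X ↑ 2 ⊕ const 1ℤ) ⊗ g a) ↑ (4 ℕ.* m))
                 ((X ↑ (2 ℕ.* m) ⊖ X ↑ 2 ⊕ const (+ 2)) ⊗ g a ↑ (2 ℕ.* m)) n
        | eval-↑ (X ⊗ (X ↑ 2 ⊕ const 1ℤ) ⊗ g a) (4 ℕ.* m) n
        | eval-⊗ (X ⊗ (X ↑ 2 ⊕ const 1ℤ)) (g a) n
        | eval-⊗ X (X ↑ 2 ⊕ const 1ℤ) n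
        | eval-⊕ (X ↑ 2) (const 1ℤ) n
        | eval-⊗ (X ↑ (2 ℕ.* m) ⊖ X ↑ 2 ⊕ const (+ 2)) (g a ↑ (2 ℕ.* m)) n
        | eval-⊕ (X ↑ (2 ℕ.* m) ⊖ X ↑ 2) (const (+ 2)) n
        | eval-⊖ (X ↑ (2 ℕ.* m)) (X ↑ 2) n
        | eval-↑ (g a) (2 ℕ.* m) n
        | eval-X↑ (2 ℕ.* m) n
        | eval-X↑ m n
        | eval-X↑ 2 n
        | eval-X n
        | eval-const 1ℤ n
        | eval-const (+ 2) n
        = refl

-- Powers

pos-^ : ∀ m n → + (m ℕ.^ n) ≡ (+ m) ^ n
pos-^ m zero    = refl
pos-^ m (suc n) = trans (ℤ.pos-* m (m ℕ.^ n)) (cong (+ m *_) (pos-^ m n))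

∣i^n∣≡∣i∣^n : ∀ i n → ∣ i ^ n ∣ ≡ ∣ i ∣ ℕ.^ n
∣i^n∣≡∣i∣^n i zero    = refl
∣i^n∣≡∣i∣^n i (suc n) =
  trans (ℤ.∣i*j∣≡∣i∣*∣j∣ i (i ^ n)) (cong (∣ i ∣ ℕ.*_) (∣i^n∣≡∣i∣^n i n))

i^2≡+∣i∣^2 : ∀ i → i ^ 2 ≡ + (∣ i ∣ ℕ.^ 2)
i^2≡+∣i∣^2 (+ n)    = sym (pos-^ n 2)
i^2≡+∣i∣^2 -[1+ n ] = refl

-- An even power forgets the sign. This turns the powers with exponents `4 * m` and `2 * m` in `fₛ`
-- into natural numbers, so that the estimates can be made in ℕ.
i^2n≡+∣i∣^2n : ∀ i n → i ^ (2 ℕ.* n) ≡ + (∣ i ∣ ℕ.^ (2 ℕ.* n))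
i^2n≡+∣i∣^2n i n = begin
  i ^ (2 ℕ.* n)               ≡⟨ ℤ.^-*-assoc i 2 n ⟨
  (i ^ 2) ^ n                 ≡⟨ cong (_^ n) (i^2≡+∣i∣^2 i) ⟩
  (+ (∣ i ∣ ℕ.^ 2)) ^ n       ≡⟨ pos-^ (∣ i ∣ ℕ.^ 2) n ⟨
  + ((∣ i ∣ ℕ.^ 2) ℕ.^ n)     ≡⟨ cong +_ (ℕ.^-*-assoc ∣ i ∣ 2 n) ⟩
  + (∣ i ∣ ℕ.^ (2 ℕ.* n))     ∎
  where open ≡-Reasoning

a^2n≡a^n*a^n : ∀ a n → a ℕ.^ (2 ℕ.* n) ≡ a ℕ.^ n ℕ.* a ℕ.^ n
a^2n≡a^n*a^n a n =
  trans (cong (λ e → a ℕ.^ (n ℕ.+ e)) (ℕ.+-identityʳ n)) (ℕ.^-distribˡ-+-* a n n)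

^-distribʳ-* : ∀ n a b → (a ℕ.* b) ℕ.^ n ≡ a ℕ.^ n ℕ.* b ℕ.^ n
^-distribʳ-* zero    a b = refl
^-distribʳ-* (suc n) a b rewrite ^-distribʳ-* n a b =
  interchange a b (a ℕ.^ n) (b ℕ.^ n)
  where
  interchange : ∀ a b c d → a ℕ.* b ℕ.* (c ℕ.* d) ≡ a ℕ.* c ℕ.* (b ℕ.* d)
  interchange = ℕ-Solver.solve-∀

∣m^n⇒∣m : ∀ {p} → Prime p → ∀ m n → p ∣ m ℕ.^ n → p ∣ m
∣m^n⇒∣m pp m zero    p∣1 = contradiction (subst Prime (∣1⇒≡1 p∣1) pp) ¬prime[1]
∣m^n⇒∣m pp m (suc n) p∣m^ with euclidsLemma m (m ℕ.^ n) pp p∣m^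
... | inj₁ p∣m   = p∣m
... | inj₂ p∣m^n = ∣m^n⇒∣m pp m n p∣m^n

-- Infinite descent: p divides b, hence h, and the equation persists for b / p
-- and h / p.
b^m≡p*h^m⇒h≡0 : ∀ {p} → Prime p → ∀ {m} → m ≥ 2 → ∀ h b → b ℕ.^ m ≡ p ℕ.* h ℕ.^ m → h ≡ 0
b^m≡p*h^m⇒h≡0 {p} pp {suc (suc n)} (s≤s (s≤s _)) =
  <-rec (λ h → ∀ b → b ℕ.^ m ≡ p ℕ.* h ℕ.^ m → h ≡ 0) descend
  where
  m = suc (suc n)

  instance
    p≢0 = prime⇒nonZero pp

  extract : ∀ p u v → p ℕ.* (p ℕ.* u) ℕ.* v ≡ p ℕ.* (v ℕ.* u ℕ.* p)
  extract = ℕ-Solver.solve-∀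

  rotate : ∀ p u v → p ℕ.* (u ℕ.* v) ≡ p ℕ.* u ℕ.* v
  rotate = ℕ-Solver.solve-∀

  descend : ∀ h → (∀ {e} → e ℕ.< h → ∀ b → b ℕ.^ m ≡ p ℕ.* e ℕ.^ m → e ≡ 0) →
    ∀ b → b ℕ.^ m ≡ p ℕ.* h ℕ.^ m → h ≡ 0
  descend h rec b eq
    with ∣m^n⇒∣m pp b m (divides (h ℕ.^ m) (trans eq (ℕ.*-comm p (h ℕ.^ m))))
  ... | divides-refl c
    -- With `b = c * p`, cancelling one `p` leaves `h ^ m = c ^ m * p ^ suc n`. The exponent `suc n`
    -- is m - 1, positive because m ≥ 2, so a factor `p` survives.
    with ∣m^n⇒∣m pp h m (divides (c ℕ.^ m ℕ.* p ℕ.^ n) (ℕ.*-cancelˡ-≡ _ _ p (begin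
           p ℕ.* h ℕ.^ m                           ≡⟨ eq ⟨
           (c ℕ.* p) ℕ.^ m                         ≡⟨ ^-distribʳ-* m c p ⟩
           c ℕ.^ m ℕ.* p ℕ.^ m                     ≡⟨ ℕ.*-comm (c ℕ.^ m) (p ℕ.^ m) ⟩
           p ℕ.^ m ℕ.* c ℕ.^ m                     ≡⟨ extract p (p ℕ.^ n) (c ℕ.^ m) ⟩
           p ℕ.* (c ℕ.^ m ℕ.* p ℕ.^ n ℕ.* p)       ∎)))
    where open ≡-Reasoning
  ... | divides-refl zero      = refl
  -- Now `h = e * p` with `e` positive, hence `e < h`, and the induction hypothesis would force
  -- `e ≡ 0`.
  ... | divides-refl e@(suc _) = contradiction
    (rec (ℕ.m<m*n e p (ℕ.nonTrivial⇒n>1 p {{prime⇒nonTrivial pp}})) c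
      (ℕ.*-cancelʳ-≡ _ _ (p ℕ.^ m) {{ℕ.m^n≢0 p m}} (begin
        c ℕ.^ m ℕ.* p ℕ.^ m               ≡⟨ ^-distribʳ-* m c p ⟨
        (c ℕ.* p) ℕ.^ m                   ≡⟨ eq ⟩
        p ℕ.* (e ℕ.* p) ℕ.^ m             ≡⟨ cong (p ℕ.*_) (^-distribʳ-* m e p) ⟩
        p ℕ.* (e ℕ.^ m ℕ.* p ℕ.^ m)       ≡⟨ rotate p (e ℕ.^ m) (p ℕ.^ m) ⟩
        p ℕ.* e ℕ.^ m ℕ.* p ℕ.^ m         ∎)))
    λ ()
    where open ≡-Reasoning

-- (M + 1)ⁿ⁺¹ ≥ Mⁿ⁺¹ + Mⁿ, so Mⁿ⁺¹ + d lies strictly between consecutive powers.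
no-power-in-gap : ∀ n M b d → 0 ℕ.< d → d ℕ.< M ℕ.^ n →
  b ℕ.^ suc n ≢ M ℕ.^ suc n ℕ.+ d
no-power-in-gap n M b d 0<d d<M^n eq with b ℕ.≤? M
... | yes b≤M = ℕ.<-irrefl refl (begin-strict
    M ℕ.^ suc n           ≡⟨ ℕ.+-identityʳ _ ⟨
    M ℕ.^ suc n ℕ.+ 0     <⟨ ℕ.+-monoʳ-< (M ℕ.^ suc n) 0<d ⟩
    M ℕ.^ suc n ℕ.+ d     ≡⟨ eq ⟨
    b ℕ.^ suc n           ≤⟨ ℕ.^-monoˡ-≤ (suc n) b≤M ⟩
    M ℕ.^ suc n           ∎)
  where open ℕ.≤-Reasoning
... | no b≰M = ℕ.<-irrefl refl (begin-strict
    b ℕ.^ suc n                      ≡⟨ eq ⟩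
    M ℕ.^ suc n ℕ.+ d                <⟨ ℕ.+-monoʳ-< (M ℕ.^ suc n) d<M^n ⟩
    M ℕ.^ suc n ℕ.+ M ℕ.^ n          ≡⟨ ℕ.+-comm (M ℕ.^ suc n) (M ℕ.^ n) ⟩
    suc M ℕ.* M ℕ.^ n                ≤⟨ ℕ.*-mono-≤ (ℕ.≰⇒> b≰M) (ℕ.^-monoˡ-≤ n (ℕ.<⇒≤ (ℕ.≰⇒> b≰M))) ⟩
    b ℕ.^ suc n                      ∎)
  where open ℕ.≤-Reasoning

-- Taking absolute values moves the equation to ℕ, with `∣ b ∣` as base and gap d = s + z. Whatever
-- the sign of `z`, the first bound makes d positive and the second keeps it below `M ^ n`. The sign
-- matters because `x ^ m` is negative for odd m and negative x.
no-power-near : ∀ n M s z b → ∣ z ∣ ℕ.< s → s ℕ.+ ∣ z ∣ ℕ.< M ℕ.^ n →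
  + (M ℕ.^ suc n) + + s + z ≢ b ^ suc n
no-power-near n M s (+ t) b t<s small eq =
  no-power-in-gap n M ∣ b ∣ (s ℕ.+ t)
    (ℕ.<-≤-trans (ℕ.≤-<-trans z≤n t<s) (ℕ.m≤m+n s t)) small
    (trans (sym (∣i^n∣≡∣i∣^n b (suc n)))
      (trans (cong ∣_∣ (sym eq)) (ℕ.+-assoc (M ℕ.^ suc n) s t)))
-- The truncated difference `s ∸ suc t` is exact, since `∣ z ∣ = suc t` is below `s`.
no-power-near n M s -[1+ t ] b t<s small eq =
  no-power-in-gap n M ∣ b ∣ (s ℕ.∸ suc t) (ℕ.m<n⇒0<n∸m t<s)
    (ℕ.≤-<-trans (ℕ.≤-trans (ℕ.m∸n≤m s (suc t)) (ℕ.m≤m+n s (suc t))) small)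
    (trans (sym (∣i^n∣≡∣i∣^n b (suc n)))
      (trans (cong ∣_∣ (sym eq))
        (trans (cong ∣_∣ (ℤ.⊖-≥ (ℕ.≤-trans (ℕ.<⇒≤ t<s) (ℕ.m≤n+m s (M ℕ.^ suc n)))))
          (ℕ.+-∸-assoc (M ℕ.^ suc n) (ℕ.<⇒≤ t<s)))))

-- The estimates, with p = |x|, q = |g(x)|, y = |x|^m and G = |g(x)|^{2m}

-- Replacing `p²` by its upper bound `y` only lowers the right-hand side; with y = t + 1 the bracket
-- becomes t(t + 1) + 2 ≥ t + 2 > y, and the factor `G` is at least 1.
y<r*G : ∀ {p² y G} → .{{ℕ.NonZero y}} → .{{ℕ.NonZero G}} → p² ℕ.≤ y →
  y ℕ.< (y ℕ.* y ℕ.∸ p² ℕ.+ 2) ℕ.* G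
y<r*G {p²} {y@(suc t)} {G} p²≤y = begin-strict
  suc t                                  ≡⟨ ℕ.+-comm 1 t ⟩
  t ℕ.+ 1                                <⟨ ℕ.+-monoʳ-< t (s≤s (s≤s z≤n)) ⟩
  t ℕ.+ 2                                ≤⟨ ℕ.+-monoˡ-≤ 2 (ℕ.m≤m*n t (suc t)) ⟩
  -- `y * y` unfolds to `y + t * suc t`, so subtracting `y` leaves `t * suc t`.
  t ℕ.* suc t ℕ.+ 2                      ≡⟨ cong (ℕ._+ 2) (ℕ.m+n∸m≡n y (t ℕ.* suc t)) ⟨
  (y ℕ.* y ℕ.∸ y) ℕ.+ 2                  ≤⟨ ℕ.+-monoˡ-≤ 2 (ℕ.∸-monoʳ-≤ (y ℕ.* y) p²≤y) ⟩
  (y ℕ.* y ℕ.∸ p²) ℕ.+ 2                 ≤⟨ ℕ.m≤m*n _ G ⟩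
  (y ℕ.* y ℕ.∸ p² ℕ.+ 2) ℕ.* G           ∎
  where open ℕ.≤-Reasoning

-- The bracket is at most 2y² and `y` is at most y²G, so the left-hand side is at most 3y²G; a
-- fourth positive copy of y²G gives strictness.
r*G+y<4y²G : ∀ {p² y G} → .{{ℕ.NonZero p²}} → .{{ℕ.NonZero y}} → .{{ℕ.NonZero G}} →
  p² ℕ.≤ y → (y ℕ.* y ℕ.∸ p² ℕ.+ 2) ℕ.* G ℕ.+ y ℕ.< 4 ℕ.* (y ℕ.* y ℕ.* G)
r*G+y<4y²G {p²} {y} {G} p²≤y = begin-strict
  (y ℕ.* y ℕ.∸ p² ℕ.+ 2) ℕ.* G ℕ.+ y     ≤⟨ ℕ.+-mono-≤ (ℕ.*-monoˡ-≤ G r≤2y²) y≤y²G ⟩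
  (y² ℕ.+ y²) ℕ.* G ℕ.+ y² ℕ.* G         <⟨ ℕ.m<m+n _ (ℕ.>-nonZero⁻¹ (y² ℕ.* G)) ⟩
  (y² ℕ.+ y²) ℕ.* G ℕ.+ y² ℕ.* G ℕ.+ y² ℕ.* G
                                         ≡⟨ collect y² G ⟩
  4 ℕ.* (y ℕ.* y ℕ.* G)                  ∎
  where
  open ℕ.≤-Reasoning
  y² = y ℕ.* y
  instance
    y²≢0 : ℕ.NonZero y²
    y²≢0 = ℕ.m*n≢0 y y
    y²G≢0 : ℕ.NonZero (y² ℕ.* G)
    y²G≢0 = ℕ.m*n≢0 y² G
  y≤y²G : y ℕ.≤ y² ℕ.* G
  y≤y²G = ℕ.≤-trans (ℕ.m≤m*n y y) (ℕ.m≤m*n y² G)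
  p²≤y² : p² ℕ.≤ y²
  p²≤y² = ℕ.≤-trans p²≤y (ℕ.m≤m*n y y)
  r≤2y² : y² ℕ.∸ p² ℕ.+ 2 ℕ.≤ y² ℕ.+ y²
  r≤2y² = begin
    -- The 2 is split as 1 + 1: one unit is bounded by `p²`, which undoes the subtraction, the other
    -- by `y²`.
    y² ℕ.∸ p² ℕ.+ 2              ≡⟨ ℕ.+-assoc (y² ℕ.∸ p²) 1 1 ⟨
    y² ℕ.∸ p² ℕ.+ 1 ℕ.+ 1        ≤⟨ ℕ.+-mono-≤ (ℕ.+-monoʳ-≤ (y² ℕ.∸ p²) (ℕ.>-nonZero⁻¹ p²)) (ℕ.>-nonZero⁻¹ y²) ⟩
    y² ℕ.∸ p² ℕ.+ p² ℕ.+ y²      ≡⟨ cong (ℕ._+ y²) (ℕ.m∸n+n≡m p²≤y²) ⟩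
    y² ℕ.+ y²                    ∎
  collect : ∀ u v → (u ℕ.+ u) ℕ.* v ℕ.+ u ℕ.* v ℕ.+ u ℕ.* v ≡ 4 ℕ.* (u ℕ.* v)
  collect = ℕ-Solver.solve-∀

-- Two facts suffice: the factor `c = p ^ 2 + 1` is at least 2, so its power supplies the 4; and 2m
-- ≤ 4(m - 1) for m ≥ 2, so passing to the larger exponent cannot decrease a power of `w ≥ 1`.
4y²G≤M^n : ∀ n p q → .{{ℕ.NonZero p}} → .{{ℕ.NonZero q}} →
  let m = 2 ℕ.+ n; y = p ℕ.^ m in
  4 ℕ.* (y ℕ.* y ℕ.* q ℕ.^ (2 ℕ.* m)) ℕ.≤ ((p ℕ.* (p ℕ.^ 2 ℕ.+ 1) ℕ.* q) ℕ.^ 4) ℕ.^ (1 ℕ.+ n)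
4y²G≤M^n n p q = begin
  4 ℕ.* (y ℕ.* y ℕ.* G)                          ≡⟨ cong (λ u → 4 ℕ.* (u ℕ.* G)) (a^2n≡a^n*a^n p m) ⟨
  4 ℕ.* (p ℕ.^ (2 ℕ.* m) ℕ.* G)                  ≤⟨ ℕ.*-monoˡ-≤ _ 4≤c ⟩
  c ℕ.^ (2 ℕ.* m) ℕ.* (p ℕ.^ (2 ℕ.* m) ℕ.* G)    ≡⟨ swap _ (p ℕ.^ (2 ℕ.* m)) _ ⟩
  p ℕ.^ (2 ℕ.* m) ℕ.* c ℕ.^ (2 ℕ.* m) ℕ.* G      ≡⟨ cong (ℕ._* G) (^-distribʳ-* (2 ℕ.* m) p c) ⟨
  (p ℕ.* c) ℕ.^ (2 ℕ.* m) ℕ.* G                  ≡⟨ ^-distribʳ-* (2 ℕ.* m) (p ℕ.* c) q ⟨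
  w ℕ.^ (2 ℕ.* m)                                ≤⟨ ℕ.^-monoʳ-≤ w 2m≤4[m-1] ⟩
  w ℕ.^ (4 ℕ.* (1 ℕ.+ n))                        ≡⟨ ℕ.^-*-assoc w 4 (1 ℕ.+ n) ⟨
  (w ℕ.^ 4) ℕ.^ (1 ℕ.+ n)                        ∎
  where
  open ℕ.≤-Reasoning
  m = 2 ℕ.+ n
  y = p ℕ.^ m
  c = p ℕ.^ 2 ℕ.+ 1
  G = q ℕ.^ (2 ℕ.* m)
  w = p ℕ.* c ℕ.* q
  2≤c : 2 ℕ.≤ c
  2≤c = ℕ.+-monoˡ-≤ 1 (ℕ.m^n>0 p 2)
  instance
    c≢0 : ℕ.NonZero c
    c≢0 = ℕ.>-nonZero (ℕ.<⇒≤ 2≤c)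
    pc≢0 : ℕ.NonZero (p ℕ.* c)
    pc≢0 = ℕ.m*n≢0 p c
    w≢0 : ℕ.NonZero w
    w≢0 = ℕ.m*n≢0 (p ℕ.* c) q
  4≤c : 4 ℕ.≤ c ℕ.^ (2 ℕ.* m)
  -- 4 = 2² ≤ c² ≤ c^(2m).
  4≤c = ℕ.≤-trans (ℕ.^-monoˡ-≤ 2 2≤c) (ℕ.^-monoʳ-≤ c (ℕ.m≤m*n 2 m))
  swap : ∀ a b d → a ℕ.* (b ℕ.* d) ≡ b ℕ.* a ℕ.* d
  swap = ℕ-Solver.solve-∀
  split : ∀ n → 4 ℕ.* (1 ℕ.+ n) ≡ 2 ℕ.* (2 ℕ.+ n) ℕ.+ 2 ℕ.* n
  split = ℕ-Solver.solve-∀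
  2m≤4[m-1] : 2 ℕ.* m ℕ.≤ 4 ℕ.* (1 ℕ.+ n)
  2m≤4[m-1] = ℕ.≤-trans (ℕ.m≤m+n _ (2 ℕ.* n)) (ℕ.≤-reflexive (sym (split n)))

-- The values of fₛ

fₛ-root : ∀ {k} {m} → m ≥ 2 → (a : Vector ℤ k) → ∀ i → eval (fₛ m a) (a i) ≡ a i ^ m
-- Exposing `m` as a successor lets `0ℤ ^ (4 * m)` and `0ℤ ^ (2 * m)` compute to 0; with exponent 0
-- they would be 1.
fₛ-root {m = m@(suc _)} m≥2 a i
  rewrite eval-fₛ m a (a i) | g-root a i
        | ℤ.*-zeroʳ (a i * (a i ^ 2 + 1ℤ))
        | ℤ.*-zeroʳ (a i ^ (2 ℕ.* m) - a i ^ 2 + + 2) = ℤ.+-identityˡ (a i ^ m)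

∣x[x²+1]G∣ : ∀ x G → ∣ x * (x ^ 2 + 1ℤ) * G ∣ ≡ ∣ x ∣ ℕ.* (∣ x ∣ ℕ.^ 2 ℕ.+ 1) ℕ.* ∣ G ∣
∣x[x²+1]G∣ x G = begin
  ∣ x * (x ^ 2 + 1ℤ) * G ∣                      ≡⟨ ℤ.∣i*j∣≡∣i∣*∣j∣ (x * (x ^ 2 + 1ℤ)) G ⟩
  ∣ x * (x ^ 2 + 1ℤ) ∣ ℕ.* ∣ G ∣                ≡⟨ cong (ℕ._* ∣ G ∣) (ℤ.∣i*j∣≡∣i∣*∣j∣ x (x ^ 2 + 1ℤ)) ⟩
  ∣ x ∣ ℕ.* ∣ x ^ 2 + 1ℤ ∣ ℕ.* ∣ G ∣            ≡⟨ cong (λ u → ∣ x ∣ ℕ.* ∣ u + 1ℤ ∣ ℕ.* ∣ G ∣) (i^2≡+∣i∣^2 x) ⟩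
  ∣ x ∣ ℕ.* (∣ x ∣ ℕ.^ 2 ℕ.+ 1) ℕ.* ∣ G ∣       ∎
  where open ≡-Reasoning

fₛ-nonpower : ∀ {k} {m} → m ≥ 2 → (a : Vector ℤ k) → ∀ x → x ≢ 0ℤ → (∀ i → x ≢ a i) →
  eval (fₛ m a) x ∉ 𝒫 m
fₛ-nonpower {m = m@(suc (suc n))} (s≤s (s≤s _)) a x x≢0 x≢a (b , eq) =
  no-power-near (suc n) M (r ℕ.* G) (x ^ m) b
    (subst (ℕ._< r ℕ.* G) (sym ∣z∣≡y) (y<r*G p²≤y))
    (subst (λ z → r ℕ.* G ℕ.+ z ℕ.< M ℕ.^ suc n) (sym ∣z∣≡y)
      (ℕ.<-≤-trans (r*G+y<4y²G p²≤y) (4y²G≤M^n n p q)))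
    (trans (sym value) eq)
  where
  p = ∣ x ∣
  γ = eval (g a) x
  q = ∣ γ ∣
  y = p ℕ.^ m
  G = q ℕ.^ (2 ℕ.* m)
  w = p ℕ.* (p ℕ.^ 2 ℕ.+ 1) ℕ.* q
  M = w ℕ.^ 4
  -- No truncation occurs: `p ^ 2 ≤ y ≤ y * y`, so `r` is the true value of x^(2m) - x² + 2.
  r = y ℕ.* y ℕ.∸ p ℕ.^ 2 ℕ.+ 2
  instance
    p≢0 : ℕ.NonZero p
    p≢0 = ℕ.≢-nonZero (x≢0 ∘ ℤ.∣i∣≡0⇒i≡0)
    q≢0 : ℕ.NonZero q
    q≢0 = ℕ.≢-nonZero (g-nonroot a x x≢a ∘ ℤ.∣i∣≡0⇒i≡0)
    p²≢0 : ℕ.NonZero (p ℕ.^ 2)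
    p²≢0 = ℕ.m^n≢0 p 2
    y≢0 : ℕ.NonZero y
    y≢0 = ℕ.m^n≢0 p m
    G≢0 : ℕ.NonZero G
    G≢0 = ℕ.m^n≢0 q (2 ℕ.* m)
  ∣z∣≡y : ∣ x ^ m ∣ ≡ y
  ∣z∣≡y = ∣i^n∣≡∣i∣^n x m
  p²≤y : p ℕ.^ 2 ℕ.≤ y
  p²≤y = ℕ.^-monoʳ-≤ p {2} {m} (s≤s (s≤s z≤n))

  leading : (x * (x ^ 2 + 1ℤ) * γ) ^ (4 ℕ.* m) ≡ + (M ℕ.^ m)
  leading = begin
    -- `4` is `2 * 2` by computation, so associativity exhibits an even exponent and the sign of `u`
    -- disappears.
    u ^ (4 ℕ.* m)                          ≡⟨ cong (u ^_) (ℕ.*-assoc 2 2 m) ⟩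
    u ^ (2 ℕ.* (2 ℕ.* m))                  ≡⟨ i^2n≡+∣i∣^2n u (2 ℕ.* m) ⟩
    + (∣ u ∣ ℕ.^ (2 ℕ.* (2 ℕ.* m)))        ≡⟨ cong₂ (λ v e → + (v ℕ.^ e)) (∣x[x²+1]G∣ x γ) (sym (ℕ.*-assoc 2 2 m)) ⟩
    + (w ℕ.^ (4 ℕ.* m))                    ≡⟨ cong +_ (ℕ.^-*-assoc w 4 m) ⟨
    + (M ℕ.^ m)                            ∎
    where
    open ≡-Reasoning
    u = x * (x ^ 2 + 1ℤ) * γ

  middle : (x ^ (2 ℕ.* m) - x ^ 2 + + 2) * γ ^ (2 ℕ.* m) ≡ + (r ℕ.* G)
  middle = begin
    (x ^ (2 ℕ.* m) - x ^ 2 + + 2) * γ ^ (2 ℕ.* m)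
      ≡⟨ cong₂ (λ u v → (u - v + + 2) * γ ^ (2 ℕ.* m)) (i^2n≡+∣i∣^2n x m) (i^2≡+∣i∣^2 x) ⟩
    (+ (p ℕ.^ (2 ℕ.* m)) - + (p ℕ.^ 2) + + 2) * γ ^ (2 ℕ.* m)
      ≡⟨ cong₂ (λ u v → (+ u - + (p ℕ.^ 2) + + 2) * v) (a^2n≡a^n*a^n p m) (i^2n≡+∣i∣^2n γ m) ⟩
    (+ (y ℕ.* y) - + (p ℕ.^ 2) + + 2) * + G
      ≡⟨ cong (λ u → (u + + 2) * + G) (trans (ℤ.m-n≡m⊖n (y ℕ.* y) (p ℕ.^ 2))
           (ℤ.⊖-≥ (ℕ.≤-trans p²≤y (ℕ.m≤m*n y y)))) ⟩
    + r * + G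
      ≡⟨ ℤ.pos-* r G ⟨
    + (r ℕ.* G) ∎
    where open ≡-Reasoning

  value : eval (fₛ m a) x ≡ + (M ℕ.^ m) + + (r ℕ.* G) + x ^ m
  value = trans (eval-fₛ m a x) (cong₂ (λ u v → u + v + x ^ m) leading middle)

fₛ0-nonpower : ∀ {k} {m} → m ≥ 2 → (a : Vector ℤ k) → (∀ i → 0ℤ ≢ a i) →
  eval (fₛ m a) 0ℤ ∉ 𝒫 m
fₛ0-nonpower {m = m@(suc (suc _))} m≥2@(s≤s (s≤s _)) a 0≢a (b , eq) =
  g-nonroot a 0ℤ 0≢a (ℤ.∣i∣≡0⇒i≡0 (ℕ.m^n≡0⇒m≡0 q 2
    -- Reading `q ^ (2 * m)` as `(q ^ 2) ^ m` gives the descent equation with `p = 2` and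
    -- `h = q ^ 2`; it forces `g` to vanish at 0.
    (b^m≡p*h^m⇒h≡0 prime[2] m≥2 (q ℕ.^ 2) ∣ b ∣ (begin
      ∣ b ∣ ℕ.^ m                         ≡⟨ ∣i^n∣≡∣i∣^n b m ⟨
      ∣ b ^ m ∣                           ≡⟨ cong ∣_∣ eq ⟨
      ∣ eval (fₛ m a) 0ℤ ∣                ≡⟨ cong ∣_∣ value ⟩
      ∣ + 2 * γ ^ (2 ℕ.* m) ∣             ≡⟨ ℤ.∣i*j∣≡∣i∣*∣j∣ (+ 2) (γ ^ (2 ℕ.* m)) ⟩
      2 ℕ.* ∣ γ ^ (2 ℕ.* m) ∣             ≡⟨ cong (2 ℕ.*_) (∣i^n∣≡∣i∣^n γ (2 ℕ.* m)) ⟩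
      2 ℕ.* q ℕ.^ (2 ℕ.* m)               ≡⟨ cong (2 ℕ.*_) (ℕ.^-*-assoc q 2 m) ⟨
      2 ℕ.* (q ℕ.^ 2) ℕ.^ m               ∎))))
  where
  open ≡-Reasoning
  γ = eval (g a) 0ℤ
  q = ∣ γ ∣
  value : eval (fₛ m a) 0ℤ ≡ + 2 * γ ^ (2 ℕ.* m)
  -- Since `m` is a visible successor, the powers of 0 compute to 0, the middle bracket computes to
  -- 2, and only two zero summands remain to be removed.
  value = trans (eval-fₛ m a 0ℤ)
    (trans (ℤ.+-identityʳ _) (ℤ.+-identityˡ (+ 2 * γ ^ (2 ℕ.* m))))

theorem3p1 : (m : ℕ) → m ≥ 2 → (k : ℕ) (a : Vector ℤ k) →
    Injective _≡_ _≡_ (λ i → a i ^ m) →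
    (Powers m a ⊆ Values (fₛ m a) ∩ 𝒫 m)
    × ((x : ℤ) → x ≢ 0ℤ → (∀ i → x ≢ a i) → eval (fₛ m a) x ∉ 𝒫 m)
    × (Values (fₛ m a) ∩ 𝒫 m ≐ Powers m a)
theorem3p1 m m≥2 k a _ = powers⊆values , fₛ-nonpower m≥2 a , values⊆powers , powers⊆values
  where
  powers⊆values : Powers m a ⊆ Values (fₛ m a) ∩ 𝒫 m
  powers⊆values (i , z≡aᵢ^m) = (a i , trans z≡aᵢ^m (sym (fₛ-root m≥2 a i))) , (a i , z≡aᵢ^m)

  values⊆powers : Values (fₛ m a) ∩ 𝒫 m ⊆ Powers m a
  -- Roots are tested first, so that 0, when it is some `a i`, counts as a root; the later case
  -- `x = 0` then has `g` nonzero at 0.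
  values⊆powers ((x , z≡fx) , (b , z≡b^m)) with any? (λ i → x ℤ.≟ a i)
  ... | yes (i , refl) = i , trans z≡fx (fₛ-root m≥2 a i)
  ... | no ∄i with x ℤ.≟ 0ℤ
  ...   | yes refl = contradiction (b , trans (sym z≡fx) z≡b^m)
                       (fₛ0-nonpower m≥2 a (λ i 0≡aᵢ → ∄i (i , 0≡aᵢ)))
  ...   | no x≢0   = contradiction (b , trans (sym z≡fx) z≡b^m)
                       (fₛ-nonpower m≥2 a x x≢0 (λ i x≡aᵢ → ∄i (i , x≡aᵢ)))
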